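{- Let $\mathcal{G}=(V,E,\lambda)$ be a happy compressed temporal graph with $|V|\ge 2$. If $\mathcal{G}$ is acyclic and temporally connected, then the set of divergent edges is exactly $E^-$ and the set of convergent edges is exactly $E^+$. In other words, the kernel of $\mathcal{G}$ is the entire graph.
   Context: A happy temporal graph is a triple $\mathcal{G}=(V,E,\lambda)$ where $(V,E)$ is a finite simple undirected graph (the footprint) and $\lambda:E\to\{1,2,3,\dots\}$ assigns a single time label to each edge, such that two distinct edges sharing an endpoint have different labels. It is compressed if for every edge $e$ with $\lambda(e)>1$ there is an edge $e'$ adjacent to $e$ with $\lambda(e')=\lambda(e)-1$. A temporal walk is a walk in the footprint along which edge labels are strictly increasing (so no edge is repeated); the empty walk is allowed. For vertices $u,v$ and edges $e,e'$: $u\leadsto v$ means there is a temporal walk from $u$ to $v$; $v\leadsto e$ means some temporal walk starts at $v$ and traverses $e$; $e\leadsto v$ means some temporal walk traverses $e$ and ends at $v$; $e\leadsto e'$ means some temporal walk traverses $e$ and $e'$ in this order, not necessarily consecutively (with $e\leadsto e$ always). Edges may be traversed in either direction. $\mathcal{G}$ is temporally connected if $u\leadsto v$ for all $u,v\in V$. A temporal cycle is a nonempty temporal walk from a vertex to itself; $\mathcal{G}$ is acyclic if it has no temporal cycle. For a vertex $v$, $e^-(v)$ and $e^+(v)$ are the edges incident to $v$ with smallest and largest label; $E^-=\{e^-(v):v\in V\}$ and $E^+=\{e^+(v):v\in V\}$. An edge $e$ is a source edge if $e\leadsto v$ for all $v\in V$, and a sink edge if $v\leadsto e$ for all $v\in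 V$. A divergent edge is a source edge $e$ such that there is no other source edge $e'\neq e$ with $e\leadsto e'$. A div-sink edge is a sink edge $e$ such that $d\leadsto e$ for every divergent edge $d$. A convergent edge is a div-sink edge $e$ such that there is no other div-sink edge $e'\ne e$ with $e'\leadsto e$. The kernel of $\mathcal{G}$ is the set of edges $e$ such that $d\leadsto e$ for at least one divergent edge $d$ and $e\leadsto c$ for at least one convergent edge $c$ (it includes the divergent and convergent edges). -}

module Defs where

open import Data.Nat using (ℕ; _∸_; _≤_; _<_)
open import Data.Fin using (Fin)
open import Data.List using (List; []; _∷_)
open import Data.List.Membership.Propositional using (_∈_)
open import Data.List.Relation.Binary.Sublist.Propositional using (_⊆_)
open import Data.List.Relation.Unary.Linked using (Linked)
open import Data.Product using (∃; ∃-syntax; _×_; _,_)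
open import Data.Sum using (_⊎_)
open import Level using (0ℓ)
open import Relation.Binary.PropositionalEquality using (_≡_; _≢_)
open import Relation.Nullary using (¬_)
open import Relation.Unary using (Pred)

-- The finite sets V and E are Fin order and Fin size.  The pair `ends e` lists
-- the endpoints of e in an arbitrary order; only the symmetric relation
-- `Joins` is used afterwards, so edges are undirected.
record HappyTemporalGraph : Set where
  field
    order size : ℕ

  Vertex : Set
  Vertex = Fin order

  Edge : Set
  Edge = Fin size

  field
    ends  : Edge → Vertex × Vertex
    label : Edge → ℕ

  Joins : Edge → Vertex → Vertex → Set
  Joins e u v = ends e ≡ (u , v) ⊎ ends e ≡ (v , u)

  Incident : Edge → Vertex → Set
  Incident e v = ∃[ u ] Joins e u v

  Adjacent : Edge → Edge → Set
  Adjacent e e′ = e ≢ e′ × ∃[ v ] (Incident e v × Incident e′ v)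

  field
    loopless   : ∀ e v → ¬ Joins e v v
    noParallel : ∀ e e′ u v → Joins e u v → Joins e′ u v → e ≡ e′
    label≥1    : ∀ e → 1 ≤ label e
    happy      : ∀ e e′ → Adjacent e e′ → label e ≢ label e′

  data Walk : Vertex → Vertex → Set where
    []   : ∀ {v} → Walk v v
    step : ∀ {u v w} (e : Edge) → Joins e u v → Walk v w → Walk u w

  edges : ∀ {u v} → Walk u v → List Edge
  edges []           = []
  edges (step e _ p) = e ∷ edges p

  Temporal : ∀ {u v} → Walk u v → Set
  Temporal p = Linked (λ e e′ → label e < label e′) (edges p)

  infix 4 _⇝ᵛᵛ_ _⇝ᵛᵉ_ _⇝ᵉᵛ_ _⇝ᵉᵉ_

  _⇝ᵛᵛ_ : Vertex → Vertex → Set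
  u ⇝ᵛᵛ v = ∃ λ (p : Walk u v) → Temporal p

  _⇝ᵛᵉ_ : Vertex → Edge → Set
  v ⇝ᵛᵉ e = ∃[ w ] ∃ λ (p : Walk v w) → Temporal p × e ∈ edges p

  _⇝ᵉᵛ_ : Edge → Vertex → Set
  e ⇝ᵉᵛ v = ∃[ u ] ∃ λ (p : Walk u v) → Temporal p × e ∈ edges p

  -- _⊆_ is the (order-preserving) sublist relation: e occurs before e′ in the
  -- walk, not necessarily consecutively.
  _⇝ᵉᵉ_ : Edge → Edge → Set
  e ⇝ᵉᵉ e′ = e ≡ e′ ⊎
    (∃[ u ] ∃[ v ] ∃ λ (p : Walk u v) → Temporal p × (e ∷ e′ ∷ []) ⊆ edges p)

  Compressed : Set
  Compressed = ∀ e → 1 < label e →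
    ∃[ e′ ] (Adjacent e e′ × label e′ ≡ label e ∸ 1)

  TemporallyConnected : Set
  TemporallyConnected = ∀ u v → u ⇝ᵛᵛ v

  TemporalCycle : Set
  TemporalCycle = ∃[ v ] ∃ λ (p : Walk v v) → Temporal p × edges p ≢ []

  Acyclic : Set
  Acyclic = ¬ TemporalCycle

  -- `IsMinAt v e` says e = e⁻(v) and `IsMaxAt v e` says e = e⁺(v): such an edge
  -- is unique by `happy`, and exists unless v is isolated.
  IsMinAt IsMaxAt : Vertex → Pred Edge 0ℓ
  IsMinAt v e = Incident e v × (∀ e′ → Incident e′ v → label e ≤ label e′)
  IsMaxAt v e = Incident e v × (∀ e′ → Incident e′ v → label e′ ≤ label e)

  E⁻ E⁺ : Pred Edge 0ℓ
  E⁻ e = ∃[ v ] IsMinAt v e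
  E⁺ e = ∃[ v ] IsMaxAt v e

  Source Sink Divergent DivSink Convergent Kernel : Pred Edge 0ℓ
  Source e     = ∀ v → e ⇝ᵉᵛ v
  Sink e       = ∀ v → v ⇝ᵛᵉ e
  Divergent e  = Source e × ¬ (∃[ e′ ] (Source e′ × e′ ≢ e × e ⇝ᵉᵉ e′))
  DivSink e    = Sink e × (∀ d → Divergent d → d ⇝ᵉᵉ e)
  Convergent e = DivSink e × ¬ (∃[ e′ ] (DivSink e′ × e′ ≢ e × e′ ⇝ᵉᵉ e))
  Kernel e     = (∃[ d ] (Divergent d × d ⇝ᵉᵉ e)) × (∃[ c ] (Convergent c × e ⇝ᵉᵉ c))

{-# OPTIONS --safe #-}

-- An edge f = ux that is earlier than an adjacent source edge e = uv closes a
-- cycle: e ⇝ x, and the part of that walk after e can be preceded by x –f– u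
-- (followed by u –e– v if e is traversed from u to v).  Hence a source edge is
-- the earliest edge at both of its endpoints.  Conversely, e⁻(v) is a source
-- edge, because a walk out of v that does not start with e⁻(v) can be preceded
-- by it.  So the source edges are exactly E⁻, and since the second edge of a
-- walk is never earliest at both endpoints, no source edge is followed by
-- another one.  Reversing time treats the sink edges.
module Submission where

open import Defs
open import Data.Nat using (_≤_; _<_)
open import Data.Nat.Properties using (<-trans; ≤∧≢⇒<; ≮⇒≥; <⇒≱)
open import Data.Fin.Properties using (_≟_; any?)
open import Data.List using ([]; _∷_; _ʳ++_; reverse; filter; allFin)
open import Data.List.Extrema.Nat
  using (argmin; argmax; argmin-all; argmax-all; f[argmin]≤f[xs]; f[xs]≤f[argmax])
open import Data.List.Membership.Propositional using (_∈_)
open import Data.List.Membership.Propositional.Properties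
  using (∈-filter⁺; ∈-allFin)
open import Data.List.Relation.Binary.Sublist.Propositional
  using (_⊆_; []; _∷_; _∷ʳ_; from∈; to∈)
open import Data.List.Relation.Unary.All as All using ()
open import Data.List.Relation.Unary.All.Properties using (all-filter)
open import Data.List.Relation.Unary.Any using (here; there)
open import Data.List.Relation.Unary.Any.Properties using (reverse⁺; ¬Any[])
open import Data.List.Relation.Unary.Linked as Linked using (Linked; []; [-]; _∷_)
open import Data.Product using (∃; ∃₂; ∃-syntax; _×_; _,_; proj₁; proj₂; map₂)
open import Data.Product.Properties using (≡-dec)
open import Data.Sum using (_⊎_; inj₁; inj₂; swap)
open import Data.Unit using (tt)
open import Function using (flip; _∘_)
open import Level using (0ℓ)
open import Relation.Binary.Core using (Rel)
open import Relation.Binary.Definitions using (Transitive)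
open import Relation.Binary.PropositionalEquality
  using (_≡_; _≢_; refl; sym; trans; subst)
open import Relation.Nullary using (¬_; Dec; yes; no; _⊎-dec_)
open import Relation.Unary using (_≐_; U)

module _ {A : Set} {R : Rel A 0ℓ} where

  -- The head `x` is shared by both lists, so each step of the induction carries one relation,
  -- flipped, across it.
  linked-ʳ++ : ∀ {x xs ys} → Linked R (x ∷ xs) → Linked (flip R) (x ∷ ys) →
    Linked (flip R) (xs ʳ++ (x ∷ ys))
  linked-ʳ++ [-]      ys = ys
  linked-ʳ++ (r ∷ xs) ys = linked-ʳ++ xs (r ∷ ys)

  linked-reverse : ∀ {xs} → Linked R xs → Linked (flip R) (reverse xs)
  linked-reverse {[]}     _  = []
  linked-reverse {x ∷ xs} xs↗ = linked-ʳ++ xs↗ [-]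

  linked-replace-head : Transitive R → ∀ {x y xs} → R x y →
    Linked R (y ∷ xs) → Linked R (x ∷ xs)
  linked-replace-head tr x≺y [-]         = [-]
  linked-replace-head tr x≺y (y≺z ∷ xs↗) = tr x≺y y≺z ∷ xs↗

module _ (G : HappyTemporalGraph) where
  open HappyTemporalGraph G

  incident₁ : ∀ {e u v} → Joins e u v → Incident e u
  incident₁ j = _ , swap j

  incident₂ : ∀ {e u v} → Joins e u v → Incident e v
  incident₂ j = _ , j

  has-endpoint : ∀ e → ∃[ v ] Incident e v
  has-endpoint e = proj₁ (ends e) , incident₁ (inj₁ refl)

  endpoints-unique : ∀ {e u v a b} → Joins e u v → Joins e a b →
    (a ≡ u × b ≡ v) ⊎ (a ≡ v × b ≡ u)
  endpoints-unique (inj₁ p) (inj₁ q) with refl ← trans (sym p) q = inj₁ (refl , refl)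
  endpoints-unique (inj₁ p) (inj₂ q) with refl ← trans (sym p) q = inj₂ (refl , refl)
  endpoints-unique (inj₂ p) (inj₁ q) with refl ← trans (sym p) q = inj₂ (refl , refl)
  endpoints-unique (inj₂ p) (inj₂ q) with refl ← trans (sym p) q = inj₁ (refl , refl)

  incident? : ∀ v e → Dec (Incident e v)
  incident? v e = any? λ u →
    ≡-dec _≟_ _≟_ (ends e) (u , v) ⊎-dec ≡-dec _≟_ _≟_ (ends e) (v , u)

  -- The accumulator follows the recursion of `_ʳ++_`, so the edge list of the reversal is found
  -- without any lemma on concatenation.
  reverseOnto : ∀ {u v w} → Walk u v → Walk u w → Walk v w
  reverseOnto []           q = q
  reverseOnto (step e j p) q = reverseOnto p (step e (swap j) q)

  edges-reverseOnto : ∀ {u v w} (p : Walk u v) (q : Walk u w) →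
    edges (reverseOnto p q) ≡ edges p ʳ++ edges q
  edges-reverseOnto []           q = refl
  edges-reverseOnto (step e j p) q = edges-reverseOnto p (step e (swap j) q)

  -- The order is a parameter so that time can be reversed by `flip`. For "smaller label", `Path`
  -- unfolds to `_⇝ᵛᵛ_`, and `PathThrough` with its first or last vertex quantified away to `_⇝ᵉᵛ_`
  -- or `_⇝ᵛᵉ_`.
  Path : Rel Edge 0ℓ → Vertex → Vertex → Set
  Path _≺_ u v = ∃ λ (p : Walk u v) → Linked _≺_ (edges p)

  PathThrough : Rel Edge 0ℓ → Vertex → Edge → Vertex → Set
  PathThrough _≺_ u e v = ∃ λ (p : Walk u v) → Linked _≺_ (edges p) × e ∈ edges p

  module _ {_≺_ : Rel Edge 0ℓ} where

    reverse-linked : ∀ {u v} (p : Walk u v) → Linked _≺_ (edges p) →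
      Linked (flip _≺_) (edges (reverseOnto p []))
    reverse-linked p p↗ =
      subst (Linked _) (sym (edges-reverseOnto p [])) (linked-reverse p↗)

    reverse-path : ∀ {u v} → Path _≺_ u v → Path (flip _≺_) v u
    reverse-path (p , p↗) = reverseOnto p [] , reverse-linked p p↗

    reverse-through : ∀ {u e v} → PathThrough _≺_ u e v → PathThrough (flip _≺_) v e u
    reverse-through (p , p↗ , e∈p) = reverseOnto p [] , reverse-linked p p↗ ,
      subst (_ ∈_) (sym (edges-reverseOnto p [])) (reverse⁺ e∈p)

  -- Everything here is applied both to "earlier than" and to "later than".
  module _ (_≺_ : Rel Edge 0ℓ) where

    path-after : ∀ {u e w} (p : Walk u w) → Linked _≺_ (edges p) → e ∈ edges p →
      ∃₂ λ a b → Joins e a b × ∃ λ (q : Walk b w) → Linked _≺_ (e ∷ edges q)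
    path-after (step e j q) p↗ (here refl) = _ , _ , j , q , p↗
    path-after (step f j q) p↗ (there e∈q) = path-after q (Linked.tail p↗) e∈q

    source-has-no-predecessor : Transitive _≺_ →
      (∀ {v e} → ¬ PathThrough _≺_ v e v) →
      ∀ {e f v} → (∀ w → ∃[ u ] PathThrough _≺_ u e w) →
      Incident e v → Incident f v → ¬ f ≺ e
    source-has-no-predecessor ≺-trans acyclic source (_ , e-joins) (x , f-joins) f≺e
      with _ , p , p↗ , e∈p ← source x
      with a , b , j , q , q↗ ← path-after p p↗ e∈p
      with endpoints-unique e-joins j
    -- Here `e` is traversed into the vertex it shares with `f`, so `f` takes its place; in the
    -- other case `e` leaves that vertex and stays, after `f`.
    ... | inj₁ (refl , refl) = acyclic
      (step _ f-joins q , linked-replace-head ≺-trans f≺e q↗ , here refl)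
    ... | inj₂ (refl , refl) = acyclic
      (step _ f-joins (step _ j q) , f≺e ∷ q↗ , here refl)

    least⇒source : (∀ u v → Path _≺_ u v) → ∀ {e v} → Incident e v →
      (∀ {f} → Incident f v → e ≢ f → e ≺ f) →
      ∀ w → ∃[ u ] PathThrough _≺_ u e w
    least⇒source connected {e} {v} (_ , j) least w with connected v w
    -- The empty walk means `w` is `v` itself, which `e` alone reaches from its other endpoint.
    ... | [] , _ = _ , step e j [] , [-] , here refl
    ... | p@(step f k q) , p↗ with e ≟ f
    ...   | yes refl = _ , p , p↗ , here refl
    ...   | no e≢f   = _ , step e j p , least (incident₁ k) e≢f ∷ p↗ , here refl

  -- `f` need not touch `e`, so the witness `g` is the edge right after `e`. It shows that `e` is
  -- not the latest edge at one of its endpoints.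
  successor-in-walk : ∀ {u v e f} (p : Walk u v) → Temporal p → (e ∷ f ∷ []) ⊆ edges p →
    ∃₂ λ g w → Incident e w × Incident g w × label e < label g
  successor-in-walk (step _ _ p)              p↗        (_ ∷ʳ s)   =
    successor-in-walk p (Linked.tail p↗) s
  successor-in-walk (step e j (step g k _))   (e<g ∷ _) (refl ∷ _) =
    g , _ , incident₂ j , incident₁ k , e<g

  -- Keeping the edge before `p` in view gives the first edge of `p` a predecessor too; the
  -- induction then moves forward to `f`.
  predecessor-of-later-edge : ∀ {u v w e f} (j : Joins e u v) (p : Walk v w) →
    Temporal (step e j p) → f ∈ edges p →
    ∃₂ λ g x → Incident f x × Incident g x × label g < label f
  predecessor-of-later-edge j (step f k p) (e<f ∷ _) (here refl) =
    _ , _ , incident₁ k , incident₂ j , e<f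
  predecessor-of-later-edge j (step f k p) (_ ∷ p↗)  (there f∈p) =
    predecessor-of-later-edge k p p↗ f∈p

  predecessor-in-walk : ∀ {u v e f} (p : Walk u v) → Temporal p → (e ∷ f ∷ []) ⊆ edges p →
    ∃₂ λ g w → Incident f w × Incident g w × label g < label f
  predecessor-in-walk (step _ _ p) p↗ (_ ∷ʳ s)   = predecessor-in-walk p (Linked.tail p↗) s
  predecessor-in-walk (step _ j p) p↗ (refl ∷ s) = predecessor-of-later-edge j p p↗ (to∈ s)

  min-at-exists : ∀ {v e} → Incident e v → ∃[ d ] IsMinAt v d
  min-at-exists {v} {e} i =
    -- `e` is the default value of `argmin`; being incident to `v` itself, it keeps the result
    -- incident to `v`.
    argmin label e es , argmin-all label i (all-filter (incident? v) (allFin size)) ,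
    λ f i′ → All.lookup (f[argmin]≤f[xs] e es) (∈-filter⁺ (incident? v) (∈-allFin f) i′)
    where es = filter (incident? v) (allFin size)

  max-at-exists : ∀ {v e} → Incident e v → ∃[ c ] IsMaxAt v c
  max-at-exists {v} {e} i =
    argmax label e es , argmax-all label i (all-filter (incident? v) (allFin size)) ,
    λ f i′ → All.lookup (f[xs]≤f[argmax] e es) (∈-filter⁺ (incident? v) (∈-allFin f) i′)
    where es = filter (incident? v) (allFin size)

  min-at-strict : ∀ {v d f} → IsMinAt v d → Incident f v → d ≢ f → label d < label f
  min-at-strict (i , least) i′ d≢f = ≤∧≢⇒< (least _ i′) (happy _ _ (d≢f , _ , i , i′))

  max-at-strict : ∀ {v c f} → IsMaxAt v c → Incident f v → c ≢ f → label f < label c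
  max-at-strict (i , greatest) i′ c≢f =
    ≤∧≢⇒< (greatest _ i′) (happy _ _ (c≢f , _ , i , i′) ∘ sym)

  adjacent⇒⇝ : ∀ {e f v} → Incident e v → Incident f v → label e < label f → e ⇝ᵉᵉ f
  adjacent⇒⇝ (_ , j) (_ , k) e<f =
    inj₂ (_ , _ , step _ j (step _ (swap k) []) , e<f ∷ [-] , refl ∷ refl ∷ [])

  min-at⇝ : ∀ {v d e} → IsMinAt v d → Incident e v → d ⇝ᵉᵉ e
  min-at⇝ {d = d} {e} m i with d ≟ e
  ... | yes d≡e = inj₁ d≡e
  ... | no  d≢e = adjacent⇒⇝ (proj₁ m) i (min-at-strict m i d≢e)

  ⇝max-at : ∀ {v e c} → Incident e v → IsMaxAt v c → e ⇝ᵉᵉ c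
  ⇝max-at {e = e} {c} i m with c ≟ e
  ... | yes c≡e = inj₁ (sym c≡e)
  ... | no  c≢e = adjacent⇒⇝ i (proj₁ m) (max-at-strict m i c≢e)

  -- A walk out of `v` either starts with `d` or starts with a later edge, and then `d`, traversed
  -- into `v`, can be put in front.
  min-at-precedes-reachable : ∀ {v d e} → IsMinAt v d → v ⇝ᵛᵉ e → d ⇝ᵉᵉ e
  min-at-precedes-reachable m (_ , step f k q , p↗ , here refl) = min-at⇝ m (incident₁ k)
  min-at-precedes-reachable {d = d} m@((_ , j) , _) (_ , step f k q , p↗ , there e∈q)
    with d ≟ f
  ... | yes refl = inj₂ (_ , _ , step f k q , p↗ , refl ∷ from∈ e∈q)
  ... | no  d≢f  = inj₂ (_ , _ , step d j (step f k q) ,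
    min-at-strict m (incident₁ k) d≢f ∷ p↗ , refl ∷ f ∷ʳ from∈ e∈q)

  module _ (acyclic : Acyclic) (connected : TemporallyConnected) where

    no-path-through : ∀ {v e} → ¬ PathThrough (λ d f → label d < label f) v e v
    no-path-through (p , p↗ , e∈p) =
      acyclic (_ , p , p↗ , λ p≡[] → ¬Any[] (subst (_ ∈_) p≡[] e∈p))

    -- The claim covers both endpoints, so it can be applied at whichever endpoint a walk enters the
    -- edge.
    source⇒min-at : ∀ {e v} → Source e → Incident e v → IsMinAt v e
    source⇒min-at source i = i , λ f i′ →
      ≮⇒≥ (source-has-no-predecessor _ <-trans no-path-through source i i′)

    -- Read backwards, the walks that make `e` a sink make it a source for the order "later than",
    -- and a closed walk in that order reverses to a temporal cycle.
    sink⇒max-at : ∀ {e v} → Sink e → Incident e v → IsMaxAt v e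
    sink⇒max-at sink i = i , λ f i′ →
      ≮⇒≥ (source-has-no-predecessor _ (flip <-trans) (no-path-through ∘ reverse-through)
        (map₂ reverse-through ∘ sink) i i′)

    E⁻⇒source : ∀ {e} → E⁻ e → Source e
    E⁻⇒source (_ , m) = least⇒source _ connected (proj₁ m) (min-at-strict m)

    E⁺⇒sink : ∀ {e} → E⁺ e → Sink e
    E⁺⇒sink (_ , m) = map₂ reverse-through ∘
      least⇒source _ (λ u v → reverse-path (connected v u)) (proj₁ m) (max-at-strict m)

    divergent⇒E⁻ : ∀ {e} → Divergent e → E⁻ e
    divergent⇒E⁻ {e} (source , _) = map₂ (source⇒min-at source) (has-endpoint e)

    E⁻⇒divergent : ∀ {e} → E⁻ e → Divergent e
    E⁻⇒divergent e∈E⁻ = E⁻⇒source e∈E⁻ , λ where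
      (f , _      , f≢e , inj₁ e≡f) → f≢e (sym e≡f)
      (f , source , _   , inj₂ (_ , _ , p , p↗ , s)) →
        let g , _ , i , i′ , g<f = predecessor-in-walk p p↗ s
        in <⇒≱ g<f (proj₂ (source⇒min-at source i) g i′)

    -- A divergent edge is earliest at some `v`, and `v` reaches the sink edge `e`.
    E⁺⇒divSink : ∀ {e} → E⁺ e → DivSink e
    E⁺⇒divSink e∈E⁺ = E⁺⇒sink e∈E⁺ , λ d divergent →
      let v , m = divergent⇒E⁻ divergent
      in min-at-precedes-reachable m (E⁺⇒sink e∈E⁺ v)

    convergent⇒E⁺ : ∀ {e} → Convergent e → E⁺ e
    convergent⇒E⁺ {e} ((sink , _) , _) = map₂ (sink⇒max-at sink) (has-endpoint e)

    E⁺⇒convergent : ∀ {e} → E⁺ e → Convergent e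
    E⁺⇒convergent e∈E⁺ = E⁺⇒divSink e∈E⁺ , λ where
      (f , _          , f≢e , inj₁ f≡e) → f≢e f≡e
      (f , (sink , _) , _   , inj₂ (_ , _ , p , p↗ , s)) →
        let g , _ , i , i′ , f<g = successor-in-walk p p↗ s
        in <⇒≱ f<g (proj₂ (sink⇒max-at sink i) g i′)

    all-in-kernel : ∀ e → Kernel e
    all-in-kernel e =
      let v , i = has-endpoint e
          d , m = min-at-exists i
          c , n = max-at-exists i
      -- One endpoint `v` of `e` serves both sides, with `d` as e⁻(v) and `c` as e⁺(v).
      in (d , E⁻⇒divergent (v , m) , min-at⇝ m i) , (c , E⁺⇒convergent (v , n) , ⇝max-at i n)

lemma3p27 : (G : HappyTemporalGraph) →
    let open HappyTemporalGraph G in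
    2 ≤ order →
    Compressed →
    Acyclic →
    TemporallyConnected →
    (Divergent ≐ E⁻) × (Convergent ≐ E⁺) × (Kernel ≐ U)
lemma3p27 G _ _ acyclic connected =
  (divergent⇒E⁻ G acyclic connected , E⁻⇒divergent G acyclic connected) ,
  (convergent⇒E⁺ G acyclic connected , E⁺⇒convergent G acyclic connected) ,
  (λ _ → tt) , (λ {e} _ → all-in-kernel G acyclic connected e)
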